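{- Every triangle-free graph $G$ satisfies $\varphi(G)\ge \chi(G)-2$.
   Context: All graphs are finite, simple, undirected and non-empty. A proper colouring of $G$ assigns colours to vertices so that no edge is monochromatic; $\mathscr{C}(G)$ is the set of proper colourings of $G$. For a proper colouring $\sigma$, the discrepancy of $\sigma$ is $\varphi_\sigma(G)=\max_{H}\big(|\sigma(V(H))|-\chi(H)\big)$, the maximum over all induced subgraphs $H$ of $G$, where $\chi$ denotes chromatic number. The chromatic discrepancy of $G$ is $\varphi(G)=\min_{\sigma\in\mathscr{C}(G)}\varphi_\sigma(G)$. -}

module Defs where

open import Data.Nat using (ℕ; suc; _≤_; _+_; _≟_)
open import Data.Fin using (Fin)
open import Data.Fin.Subset using (Subset; _∈_; Nonempty; ⊤)
open import Data.Fin.Subset.Properties using (_∈?_)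
open import Data.Bool using (Bool; true)
open import Data.List using (List; length; map; filter; allFin; deduplicate)
open import Data.Product using (Σ; _×_; ∃; ∃-syntax)
open import Relation.Binary.PropositionalEquality using (_≡_; _≢_)
open import Relation.Nullary using (¬_)

record Graph : Set where
  field
    n     : ℕ
    adj   : Fin n → Fin n → Bool
    sym   : ∀ u v → adj u v ≡ adj v u
    irrefl : ∀ u → ¬ (adj u u ≡ true)
    nonempty : 1 ≤ n

open Graph public

Adj : (G : Graph) → Fin (n G) → Fin (n G) → Set
Adj G u v = adj G u v ≡ true

TriangleFree : Graph → Set
TriangleFree G = ¬ (∃[ u ] ∃[ v ] ∃[ w ] (Adj G u v × Adj G v w × Adj G u w))

Proper : (G : Graph) → (Fin (n G) → ℕ) → Set
Proper G σ = ∀ u v → Adj G u v → σ u ≢ σ v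

ColourableOn : (G : Graph) → Subset (n G) → ℕ → Set
ColourableOn G S k =
  Σ (Fin (n G) → Fin k) λ f → ∀ u v → u ∈ S → v ∈ S → Adj G u v → f u ≢ f v

IsChromaticNumberOn : (G : Graph) → Subset (n G) → ℕ → Set
IsChromaticNumberOn G S m = ColourableOn G S m × (∀ j → ColourableOn G S j → m ≤ j)

IsChromaticNumber : Graph → ℕ → Set
IsChromaticNumber G m = IsChromaticNumberOn G ⊤ m

elements : ∀ {k} → Subset k → List (Fin k)
elements S = filter (_∈? S) (allFin _)

numColours : ∀ {k} → (Fin k → ℕ) → Subset k → ℕ
numColours σ S = length (deduplicate _≟_ (map σ (elements S)))

-- φ_σ(G) ≥ d  (for d an integer written as d = a - b with a b : ℕ, i.e. "≥ a - b"):
-- some induced subgraph H = G[S] (S non-empty) has |σ(S)| - χ(H) ≥ a - b,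
-- stated additively as  a + χ(H) ≤ |σ(S)| + b.
DiscrepancyAtLeast : (G : Graph) → (Fin (n G) → ℕ) → ℕ → ℕ → Set
DiscrepancyAtLeast G σ a b =
  Σ (Subset (n G)) λ S → Nonempty S ×
    Σ ℕ λ m → IsChromaticNumberOn G S m × (a + m ≤ numColours σ S + b)

{-# OPTIONS --safe #-}

-- Choose greedily an independent set I of vertices showing a maximal set C of the colours not yet
-- used, and discard the classes of C.  After c rounds all t colours are used, and the union S of the
-- sets I is c-colourable and shows all of them.  Going back, start with two colours for the empty
-- graph; each round costs only |C| - 1 new colours, so χ(G) ≤ t - c + 2 ≤ |σ(S)| - χ(S) + 2.  Indeed,
-- when the classes of C are put back on top of a colouring τ of the rest, one class of τ is freed: a
-- vertex u of it takes a colour of C that is absent from its neighbourhood, if there is one.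
-- Otherwise the neighbourhood of u, an independent set because G is triangle-free, shows all of C,
-- hence by maximality nothing else, so u is isolated in the rest and may join another class of τ.
module Submission where

open import Defs hiding (sym; nonempty)
import Data.Bool as Bool
open import Data.Nat using (ℕ; zero; suc; _+_; _≤_; _<_; z≤n; s≤s; _≟_)
open import Data.Nat.Properties
  using (≤-refl; ≤-reflexive; ≤-trans; ≤-pred; <⇒≱; m≤m+n; +-mono-≤; +-monoˡ-≤; +-monoʳ-≤; +-suc;
         module ≤-Reasoning)
open import Data.Nat.Solver using (module +-*-Solver)
open import Data.Fin using (Fin; zero; suc; fromℕ<; join; splitAt)
open import Data.Fin.Properties using (any?; all?; splitAt-join; suc-injective; injective⇒≤)
  renaming (_≟_ to _≟ᶠ_)
open import Data.Fin.Subset using (Subset; Nonempty; ⊤; ⊥; ⁅_⁆; _∪_) renaming (_∈_ to _∈ˢ_)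
open import Data.Fin.Subset.Properties
  using (_∈?_; nonempty?; ∈⊤; ∉⊥; x∈⁅x⁆; x∈⁅y⁆⇒x≡y; x∈p∪q⁺; x∈p∪q⁻)
open import Data.List using (List; []; _∷_; _++_; length; lookup; filter; map; allFin; deduplicate)
open import Data.List.Properties using (length-++)
open import Data.List.Membership.Propositional using (_∈_; _∉_; find; lose)
open import Data.List.Membership.Propositional.Properties
  using (∈-lookup; ∈-filter⁺; ∈-filter⁻; ∈-map⁺; ∈-map⁻; ∈-deduplicate⁺; ∈-deduplicate⁻; ∈-allFin;
         ∈-++⁻)
open import Data.List.Membership.Setoid.Properties using (index-injective)
open import Data.List.Membership.DecPropositional _≟_ using () renaming (_∈?_ to _∈ᴸ?_)
open import Data.List.Relation.Unary.All as All using (All; []; _∷_)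
open import Data.List.Relation.Unary.Any as Any using (Any; here; there)
open import Data.List.Relation.Unary.Any.Properties using (lookup-index)
open import Data.List.Relation.Unary.AllPairs using ([]; _∷_)
open import Data.List.Relation.Unary.Unique.Propositional using (Unique)
import Data.List.Relation.Unary.Unique.Propositional.Properties as Unique
open import Data.List.Relation.Unary.Unique.DecPropositional.Properties _≟_ using (deduplicate-!)
open import Data.List.Relation.Binary.Subset.Propositional using (_⊆_)
open import Data.Product using (Σ; _×_; _,_; ∃; ∃-syntax; proj₁; proj₂)
open import Data.Sum using (_⊎_; inj₁; inj₂)
open import Data.Vec as Vec using (Vec; []; _∷_)
open import Data.Vec.Properties using (lookup∘tabulate; lookup⇒[]=; []=⇒lookup)
open import Function using (_∘_)
open import Relation.Nullary using (¬_; Dec; yes; no; contradiction; ¬?)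
open import Relation.Nullary.Decidable using (map′; _×-dec_; _→-dec_; decidable-stable)
open import Relation.Unary using (Decidable)
open import Relation.Binary.PropositionalEquality

private variable
  A : Set
  k : ℕ

-- Counting with duplicate-free lists.

unique⇒lookup-injective : {xs : List A} → Unique xs →
  ∀ i j → lookup xs i ≡ lookup xs j → i ≡ j
unique⇒lookup-injective (_ ∷ _) zero zero _ = refl
unique⇒lookup-injective (x∉xs ∷ _) zero (suc j) eq =
  contradiction eq (All.lookup x∉xs (∈-lookup j))
unique⇒lookup-injective (x∉xs ∷ _) (suc i) zero eq =
  contradiction (sym eq) (All.lookup x∉xs (∈-lookup i))
unique⇒lookup-injective (_ ∷ xs!) (suc i) (suc j) eq =
  cong suc (unique⇒lookup-injective xs! i j eq)

-- Sending each position in `xs` to a position of the same entry in `ys` is injective.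
unique-⊆⇒length≤ : {xs ys : List A} → Unique xs → xs ⊆ ys → length xs ≤ length ys
unique-⊆⇒length≤ xs! xs⊆ys = injective⇒≤ λ {i} {j} eq →
  unique⇒lookup-injective xs! i j
    (index-injective (setoid _) (xs⊆ys (∈-lookup i)) (xs⊆ys (∈-lookup j)) eq)

-- Decidability of colourability and least witnesses.

any-vec? : ∀ {n} {P : Vec (Fin k) n → Set} → Decidable P → Dec (∃ P)
any-vec? {n = zero} P? = map′ (λ p → [] , p) (λ { ([] , p) → p }) (P? [])
any-vec? {n = suc n} P? = map′ (λ (x , xs , p) → x ∷ xs , p) (λ { (x ∷ xs , p) → x , xs , p })
  (any? λ x → any-vec? λ xs → P? (x ∷ xs))

least : {P : ℕ → Set} → Decidable P → ∀ c → P c →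
  ∃[ m ] P m × (∀ j → P j → m ≤ j)
least P? c p with P? 0
... | yes p₀ = 0 , p₀ , λ _ _ → z≤n
least P? zero p | no ¬p₀ = contradiction p ¬p₀
least P? (suc c) p | no ¬p₀ with least (P? ∘ suc) c p
... | m , pm , min = suc m , pm , λ where
  zero p₀ → contradiction p₀ ¬p₀
  (suc j) pj → s≤s (min j pj)

-- Candidate colourings are tabulated as vectors, over which the search is finite. With `least` this
-- yields exact chromatic numbers of induced subgraphs.
colourableOn? : (G : Graph) (S : Subset (n G)) → Decidable (ColourableOn G S)
colourableOn? G S k = map′
  (λ (f , p) → Vec.lookup f , p)
  (λ (f , p) → Vec.tabulate f , λ u v u∈S v∈S uv eq →
    p u v u∈S v∈S uv (trans (sym (lookup∘tabulate f u)) (trans eq (lookup∘tabulate f v))))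
  (any-vec? λ f → all? λ u → all? λ v →
    (u ∈? S) →-dec ((v ∈? S) →-dec
      ((adj G u v Bool.≟ Bool.true) →-dec ¬? (Vec.lookup f u ≟ᶠ Vec.lookup f v))))

_∖_ : List ℕ → List ℕ → List ℕ
R ∖ C = filter (λ x → ¬? (x ∈ᴸ? C)) R

∈-∖⁺ : ∀ {x} R C → x ∈ R → x ∉ C → x ∈ R ∖ C
∈-∖⁺ _ C = ∈-filter⁺ (λ x → ¬? (x ∈ᴸ? C))

∈-∖⁻ : ∀ {x} R C → x ∈ R ∖ C → x ∈ R × x ∉ C
∈-∖⁻ R C = ∈-filter⁻ (λ x → ¬? (x ∈ᴸ? C)) {xs = R}

∖-unique : ∀ R C → Unique R → Unique (R ∖ C)
∖-unique _ C = Unique.filter⁺ (λ x → ¬? (x ∈ᴸ? C))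

-- Independent sets and neighbourhoods.

module _ (G : Graph) where

  private
    V : Set
    V = Fin (n G)

  Independent : Subset (n G) → Set
  Independent I = ∀ u v → u ∈ˢ I → v ∈ˢ I → ¬ Adj G u v

  nbhd : V → Subset (n G)
  nbhd u = Vec.tabulate (adj G u)

  ∈-nbhd⁺ : ∀ {u v} → Adj G u v → v ∈ˢ nbhd u
  ∈-nbhd⁺ {u} {v} uv = lookup⇒[]= v _ (trans (lookup∘tabulate (adj G u) v) uv)

  ∈-nbhd⁻ : ∀ {u v} → v ∈ˢ nbhd u → Adj G u v
  ∈-nbhd⁻ {u} {v} v∈ = trans (sym (lookup∘tabulate (adj G u) v)) ([]=⇒lookup v∈)

  adj-sym : ∀ {u v} → Adj G u v → Adj G v u
  adj-sym {u} {v} uv = trans (Graph.sym G v u) uv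

  nbhd-independent : TriangleFree G → ∀ u → Independent (nbhd u)
  nbhd-independent tf u v w v∈ w∈ vw = tf (u , v , w , ∈-nbhd⁻ v∈ , vw , ∈-nbhd⁻ w∈)

  -- ColourableOn G ⊥ 0 is false, as it asks for a map from all vertices to Fin 0.
  colourableOn-∪ : ∀ {I S c} → Independent I → (Nonempty S → ColourableOn G S c) →
    ColourableOn G (I ∪ S) (suc c)
  colourableOn-∪ {I} {S} {c} ind S-col with nonempty? S
  ... | no empty = (λ _ → zero) , λ u v u∈ v∈ uv _ → ind u v (in-I u∈) (in-I v∈) uv
    where
    in-I : ∀ {v} → v ∈ˢ I ∪ S → v ∈ˢ I
    in-I v∈ with x∈p∪q⁻ I S v∈
    ... | inj₁ v∈I = v∈I
    ... | inj₂ v∈S = contradiction (_ , v∈S) empty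
  ... | yes S≢⊥ with S-col S≢⊥
  ...   | f , f-proper = g , g-proper
    where
    g : V → Fin (suc c)
    g v with v ∈? I
    ... | yes _ = zero
    ... | no _  = suc (f v)

    in-S : ∀ {v} → ¬ (v ∈ˢ I) → v ∈ˢ I ∪ S → v ∈ˢ S
    in-S v∉I v∈ with x∈p∪q⁻ I S v∈
    ... | inj₁ v∈I = contradiction v∈I v∉I
    ... | inj₂ v∈S = v∈S

    g-proper : ∀ u v → u ∈ˢ I ∪ S → v ∈ˢ I ∪ S → Adj G u v → g u ≢ g v
    g-proper u v u∈ v∈ uv eq with u ∈? I | v ∈? I
    ... | yes u∈I | yes v∈I = ind u v u∈I v∈I uv
    ... | no u∉I  | no v∉I  =
      f-proper u v (in-S u∉I u∈) (in-S v∉I v∈) uv (suc-injective eq)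

  -- Independent sets showing a saturated set of colours.

  module _ (σ : V → ℕ) where

    Shows : Subset (n G) → ℕ → Set
    Shows S x = ∃[ v ] v ∈ˢ S × σ v ≡ x

    shows? : ∀ S → Decidable (Shows S)
    shows? S x = any? λ v → (v ∈? S) ×-dec (σ v ≟ x)

    shows⇒length≤numColours : ∀ {R S} → Unique R → (∀ {x} → x ∈ R → Shows S x) →
      length R ≤ numColours σ S
    shows⇒length≤numColours {R} {S} R! shown = unique-⊆⇒length≤ R! λ x∈R →
      let v , v∈S , σv≡x = shown x∈R in
      ∈-deduplicate⁺ _≟_
        (subst (_∈ map σ (elements S)) σv≡x
          (∈-map⁺ σ (∈-filter⁺ (_∈? S) (∈-allFin v) v∈S)))

    record RainbowIndependent (R C : List ℕ) : Set where
      field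
        I           : Subset (n G)
        independent : Independent I
        unique      : Unique C
        C⊆R         : C ⊆ R
        shown       : ∀ {x} → x ∈ C → Shows I x
        nonempty    : 1 ≤ length C

    -- Maximality of `C` is tested against neighbourhoods only, the independent sets that the
    -- recolouring meets.
    Saturated : List ℕ → List ℕ → Set
    Saturated R C = ∀ u → All (Shows (nbhd u)) C → ∀ {x} → x ∈ R → Shows (nbhd u) x → x ∈ C

    -- While some neighbourhood shows all of `C` and a further colour of `R`, it replaces the
    -- current independent set. Each replacement lengthens `C`, and `b` bounds how many can still
    -- follow.
    saturate : TriangleFree G → ∀ {R} → Unique R → ∀ b {C} → length R ≤ b + length C →
      RainbowIndependent R C → ∃[ D ] RainbowIndependent R D × Saturated R D
    saturate tf {R} R! b {C} bound ri
      with any? (λ u → All.all? (shows? (nbhd u)) C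
                       ×-dec Any.any? (λ x → shows? (nbhd u) x ×-dec ¬? (x ∈ᴸ? C)) R)
    ... | no none = C , ri , λ u all-C {x} x∈R sh →
      decidable-stable (x ∈ᴸ? C) λ x∉C → none (u , all-C , lose x∈R (sh , x∉C))
    ... | yes (u , all-C , extra) = continue b bound
      where
      open RainbowIndependent ri

      D : List ℕ
      D = filter (shows? (nbhd u)) R

      D! : Unique D
      D! = Unique.filter⁺ (shows? (nbhd u)) R!

      C<D : length C < length D
      C<D with find extra
      ... | x , x∈R , sh , x∉C = unique-⊆⇒length≤ (All.tabulate x≢ ∷ unique) λ where
          (here refl) → ∈-filter⁺ (shows? (nbhd u)) x∈R sh
          (there y∈C) → ∈-filter⁺ (shows? (nbhd u)) (C⊆R y∈C) (All.lookup all-C y∈C)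
        where
        x≢ : ∀ {y} → y ∈ C → x ≢ y
        x≢ y∈C refl = x∉C y∈C

      larger : RainbowIndependent R D
      larger = record
        { I           = nbhd u
        ; independent = nbhd-independent tf u
        ; unique      = D!
        ; C⊆R         = proj₁ ∘ ∈-filter⁻ (shows? (nbhd u)) {xs = R}
        ; shown       = λ x∈D → proj₂ (∈-filter⁻ (shows? (nbhd u)) {xs = R} x∈D)
        ; nonempty    = ≤-trans (s≤s z≤n) C<D
        }

      continue : ∀ b → length R ≤ b + length C → ∃[ D ] RainbowIndependent R D × Saturated R D
      -- With the budget spent, `D` would be longer than `R`, which contains it.
      continue zero bound = contradiction
        (≤-trans (unique-⊆⇒length≤ D! (proj₁ ∘ ∈-filter⁻ (shows? (nbhd u)) {xs = R})) bound)
        (<⇒≱ C<D)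
      continue (suc b) bound = saturate tf R! b
        (≤-trans bound (≤-trans (≤-reflexive (sym (+-suc b (length C)))) (+-monoʳ-≤ b C<D))) larger

    -- Putting the classes of `C` back while freeing one class.

    ColourableIn : List ℕ → ℕ → Set
    ColourableIn R k =
      Σ (V → Fin k) λ τ → ∀ u v → σ u ∈ R → σ v ∈ R → Adj G u v → τ u ≢ τ v

    module _ (σ-proper : Proper G σ) {R C : List ℕ} (sat : Saturated R C)
      {p : ℕ} (τ : V → Fin (2 + p))
      (τ-proper : ∀ u v → σ u ∈ R ∖ C → σ v ∈ R ∖ C → Adj G u v → τ u ≢ τ v) where

      -- Class `zero` of `τ` is dissolved. The left summand holds the surviving classes, with
      -- `suc j` renumbered `j`; the right one holds the classes of `C`. A vertex of the dissolved
      -- class is `moved` to a colour of `C` absent around it, or is `full` and joins the first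
      -- surviving class, which exists because `τ` has at least two colours.
      data Recolouring (v : V) : Fin (suc p) ⊎ Fin (length C) → Set where
        own   : ∀ {i} → σ v ≡ lookup C i → Recolouring v (inj₂ i)
        moved : ∀ {i} → σ v ∉ C → τ v ≡ zero → ¬ Shows (nbhd v) (lookup C i) →
                Recolouring v (inj₂ i)
        kept  : ∀ {j} → σ v ∉ C → τ v ≡ suc j → Recolouring v (inj₁ j)
        full  : σ v ∉ C → All (Shows (nbhd v)) C → Recolouring v (inj₁ zero)

      recolour : ∀ v → ∃ (Recolouring v)
      recolour v with σ v ∈ᴸ? C
      ... | yes σv∈C = inj₂ (Any.index σv∈C) , own (lookup-index σv∈C)
      ... | no σv∉C with τ v in eq
      ...   | suc j = inj₁ j , kept σv∉C eq
      ...   | zero with All.all? (shows? (nbhd v)) C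
      ...     | yes all-C = inj₁ zero , full σv∉C all-C
      ...     | no ¬all-C with any? (λ i → ¬? (shows? (nbhd v) (lookup C i)))
      ...       | yes (i , absent) = inj₂ i , moved σv∉C eq absent
      ...       | no none = contradiction
        (All.tabulate λ {x} x∈C → decidable-stable (shows? (nbhd v) x) λ absent →
          none (Any.index x∈C , absent ∘ subst (Shows (nbhd v)) (sym (lookup-index x∈C))))
        ¬all-C

      -- The colour of a neighbour `v` is shown by `nbhd u`, so saturation would put it in `C`.
      full-isolated : ∀ {u v} → All (Shows (nbhd u)) C → σ v ∈ R → σ v ∉ C → ¬ Adj G u v
      full-isolated {u} {v} all-C σv∈R σv∉C uv =
        σv∉C (sat u all-C σv∈R (v , ∈-nbhd⁺ uv , refl))

      -- Two `own` vertices would share a colour of `σ`; a `moved` vertex avoids the colours around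
      -- it; two `moved` vertices come from class `zero` of `τ`, and two `kept` ones from a common
      -- class; a `full` vertex has no neighbour among the vertices on the left side.
      recolouring-proper : ∀ {u v x} → σ u ∈ R → σ v ∈ R → Adj G u v →
        Recolouring u x → ¬ Recolouring v x
      recolouring-proper _ _ uv (own eu) (own ev) =
        σ-proper _ _ uv (trans eu (sym ev))
      recolouring-proper _ _ uv (own eu) (moved _ _ absent) =
        absent (_ , ∈-nbhd⁺ (adj-sym uv) , eu)
      recolouring-proper _ _ uv (moved _ _ absent) (own ev) =
        absent (_ , ∈-nbhd⁺ uv , ev)
      recolouring-proper u∈R v∈R uv (moved u∉C eu _) (moved v∉C ev _) =
        τ-proper _ _ (∈-∖⁺ R C u∈R u∉C) (∈-∖⁺ R C v∈R v∉C) uv (trans eu (sym ev))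
      recolouring-proper u∈R v∈R uv (kept u∉C eu) (kept v∉C ev) =
        τ-proper _ _ (∈-∖⁺ R C u∈R u∉C) (∈-∖⁺ R C v∈R v∉C) uv (trans eu (sym ev))
      recolouring-proper u∈R _ uv (kept u∉C _) (full _ all-C) =
        full-isolated all-C u∈R u∉C (adj-sym uv)
      recolouring-proper _ v∈R uv (full _ all-C) (kept v∉C _) =
        full-isolated all-C v∈R v∉C uv
      recolouring-proper _ v∈R uv (full _ all-C) (full v∉C _) =
        full-isolated all-C v∈R v∉C uv

      -- The freed class pays for one class of `C`, which is the saving of one colour per round.
      colourableIn-step : ColourableIn R (suc p + length C)
      colourableIn-step = join _ _ ∘ proj₁ ∘ recolour , λ u v u∈R v∈R uv eq →
        recolouring-proper u∈R v∈R uv (proj₂ (recolour u))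
          (subst (Recolouring v) (sym (join-injective eq)) (proj₂ (recolour v)))
        where
        join-injective : ∀ {a b : Fin (suc p) ⊎ Fin (length C)} →
          join _ _ a ≡ join _ _ b → a ≡ b
        join-injective {a} {b} eq = trans (sym (splitAt-join _ _ a))
          (trans (cong (splitAt (suc p)) eq) (splitAt-join _ _ b))

    -- Iterating the rounds over the set of colours.

    record Decomposition (R : List ℕ) : Set where
      field
        colours parts : ℕ
        -- One class is to be freed, another is to receive the isolated vertices.
        2≤colours     : 2 ≤ colours
        S             : Subset (n G)
        transversal   : ∀ {x} → x ∈ R → Shows S x
        S-colourable  : Nonempty S → ColourableOn G S parts
        R-colourable  : ColourableIn R colours
        -- Each round adds one part and one colour fewer than `C` has, hence `length C` in total;
        -- the 2 is the initial supply.
        bound         : colours + parts ≤ length R + 2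

    decomposition-step : Proper G σ → ∀ {R C} → RainbowIndependent R C → Saturated R C →
      length C + length (R ∖ C) ≤ length R → Decomposition (R ∖ C) → Decomposition R
    decomposition-step σ-proper {R} {C} ri sat split record
      { colours = suc (suc p) ; parts = c ; 2≤colours = s≤s (s≤s _) ; S = S ; transversal = tr
      ; S-colourable = S-col ; R-colourable = τ , τ-proper ; bound = bound } = record
      { colours      = suc p + length C
      ; parts        = suc c
      -- At least one class survives and `C` contributes at least one more.
      ; 2≤colours    = +-mono-≤ {1} {suc p} (s≤s z≤n) nonempty
      ; S            = I ∪ S
      ; transversal  = tr′
      ; S-colourable = λ _ → colourableOn-∪ independent S-col
      ; R-colourable = colourableIn-step σ-proper sat τ τ-proper
      ; bound        = bound′
      }
      where
      open RainbowIndependent ri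

      tr′ : ∀ {x} → x ∈ R → Shows (I ∪ S) x
      tr′ {x} x∈R with x ∈ᴸ? C
      ... | yes x∈C = let v , v∈I , e = shown x∈C in v , x∈p∪q⁺ (inj₁ v∈I) , e
      ... | no x∉C = let v , v∈S , e = tr (∈-∖⁺ R C x∈R x∉C) in v , x∈p∪q⁺ (inj₂ v∈S) , e

      bound′ : suc p + length C + suc c ≤ length R + 2
      bound′ = begin
        suc p + length C + suc c
          ≡⟨ solve 3 (λ p l c → con 1 :+ p :+ l :+ (con 1 :+ c) := l :+ (con 2 :+ p :+ c))
               refl p (length C) c ⟩
        length C + (2 + p + c)              ≤⟨ +-monoʳ-≤ (length C) bound ⟩
        length C + (length (R ∖ C) + 2)
          ≡⟨ solve 2 (λ l r → l :+ (r :+ con 2) := l :+ r :+ con 2)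
               refl (length C) (length (R ∖ C)) ⟩
        length C + length (R ∖ C) + 2       ≤⟨ +-monoˡ-≤ 2 split ⟩
        length R + 2 ∎
        where
        open ≤-Reasoning
        open +-*-Solver

    -- The bound `b` makes the recursion structural: `C` is non-empty, so `R ∖ C` is shorter than
    -- `R`.
    decompose : TriangleFree G → Proper G σ → ∀ b R → length R ≤ b → Unique R →
      (∀ {x} → x ∈ R → Shows ⊤ x) → Decomposition R
    decompose _ _ _ [] _ _ _ = record
      -- With no colour left, no edge is constrained; the two colours are there for the first step
      -- back and become the 2 of the theorem.
      { colours      = 2
      ; parts        = 0
      ; 2≤colours    = ≤-refl
      ; S            = ⊥
      ; transversal  = λ ()
      ; S-colourable = λ (_ , v∈⊥) → contradiction v∈⊥ ∉⊥
      ; R-colourable = (λ _ → zero) , λ _ _ ()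
      ; bound        = ≤-refl
      }
    decompose tf σ-proper (suc b) R@(x ∷ _) R≤1+b R! R-shown
      with saturate tf R! (length R) (m≤m+n (length R) 1) singleton
      where
      -- The enlargement starts from a single vertex of colour `x`.
      singleton : RainbowIndependent R (x ∷ [])
      singleton with R-shown (here refl)
      ... | v , _ , σv≡x = record
        { I           = ⁅ v ⁆
        ; independent = λ u w u∈ w∈ uw → Graph.irrefl G v
            (subst₂ (Adj G) (x∈⁅y⁆⇒x≡y v u∈) (x∈⁅y⁆⇒x≡y v w∈) uw)
        ; unique      = [] ∷ []
        ; C⊆R         = λ { (here refl) → here refl }
        ; shown       = λ { (here refl) → v , x∈⁅x⁆ v , σv≡x }
        ; nonempty    = ≤-refl
        }
    ... | C , ri , sat = decomposition-step σ-proper ri sat split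
      (decompose tf σ-proper b (R ∖ C) rest≤b (∖-unique R C R!) (R-shown ∘ proj₁ ∘ ∈-∖⁻ R C))
      where
      open RainbowIndependent ri

      C++rest⊆R : C ++ (R ∖ C) ⊆ R
      C++rest⊆R y∈ with ∈-++⁻ C y∈
      ... | inj₁ y∈C = C⊆R y∈C
      ... | inj₂ y∈rest = proj₁ (∈-∖⁻ R C y∈rest)

      split : length C + length (R ∖ C) ≤ length R
      split = ≤-trans (≤-reflexive (sym (length-++ C)))
        (unique-⊆⇒length≤
          (Unique.++⁺ unique (∖-unique R C R!) λ (y∈C , y∈rest) → proj₂ (∈-∖⁻ R C y∈rest) y∈C)
          C++rest⊆R)

      rest≤b : length (R ∖ C) ≤ b
      rest≤b = ≤-pred (≤-trans (+-monoˡ-≤ (length (R ∖ C)) nonempty) (≤-trans split R≤1+b))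

-- The discrepancy bound from the decomposition.

theorem1p2 : (G : Graph) → TriangleFree G → (k : ℕ) → IsChromaticNumber G k →
    (σ : Fin (n G) → ℕ) → Proper G σ → DiscrepancyAtLeast G σ k 2
theorem1p2 G tf k (_ , k-min) σ σ-proper =
  S , S≢⊥ , m , (S-m , m-min) , (begin
    k + m              ≤⟨ +-mono-≤ k≤colours (m-min parts (S-colourable S≢⊥)) ⟩
    colours + parts    ≤⟨ bound ⟩
    length R + 2       ≤⟨ +-monoˡ-≤ 2 (shows⇒length≤numColours G σ R! transversal) ⟩
    numColours σ S + 2 ∎)
  where
  open ≤-Reasoning

  R : List ℕ
  R = deduplicate _≟_ (map σ (allFin (n G)))

  R! : Unique R
  R! = deduplicate-! (map σ (allFin (n G)))

  σ∈R : ∀ v → σ v ∈ R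
  σ∈R v = ∈-deduplicate⁺ _≟_ (∈-map⁺ σ (∈-allFin v))

  R-shown : ∀ {x} → x ∈ R → Shows G σ ⊤ x
  R-shown x∈R with ∈-map⁻ σ (∈-deduplicate⁻ _≟_ (map σ (allFin (n G))) x∈R)
  ... | v , _ , refl = v , ∈⊤ , refl

  open Decomposition (decompose G σ tf σ-proper (length R) R ≤-refl R! R-shown)

  S≢⊥ : Nonempty S
  -- `G` has a vertex, and `S` must show its colour.
  S≢⊥ = let v , v∈S , _ = transversal (σ∈R (fromℕ< (Graph.nonempty G))) in v , v∈S

  k≤colours : k ≤ colours
  -- As `R` contains every colour of `σ`, `τ` is proper on all of `G`.
  k≤colours = let τ , τ-proper = R-colourable in
    k-min colours (τ , λ u v _ _ → τ-proper u v (σ∈R u) (σ∈R v))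

  chromatic : ∃ (IsChromaticNumberOn G S)
  -- The colouring with `parts` colours bounds the search for the exact chromatic number of `S`.
  chromatic = least (colourableOn? G S) parts (S-colourable S≢⊥)

  m : ℕ
  m = proj₁ chromatic

  S-m : ColourableOn G S m
  S-m = proj₁ (proj₂ chromatic)

  m-min : ∀ j → ColourableOn G S j → m ≤ j
  m-min = proj₂ (proj₂ chromatic)
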